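{- If a graph $G$ has $n$ vertices and maximum degree $\Delta(G)=n-1$, then $G$ is antimagic.
   Context: All graphs are finite, undirected and simple; $\Delta(G)$ denotes the maximum degree of $G$. An antimagic labeling of a graph with $m$ edges and $n$ vertices is a bijection from the set of edges to the integers $1,\ldots,m$ such that all $n$ vertex sums are pairwise distinct, where a vertex sum is the sum of the labels of all edges incident with the same vertex. A graph is called antimagic if it has an antimagic labeling.
   Formalization: The case n = 2 is excluded: the single-edge graph on two vertices has maximum degree n − 1 = 1 but is not antimagic, since both vertex sums equal 1; no other graph satisfying the hypothesis is lost. -}

module Defs where

open import Level using (0ℓ)
open import Data.Nat using (ℕ; suc)
open import Data.Nat.ListAction using (sum)
open import Data.Fin using (Fin; toℕ; _<_; _<?_; _≟_)
open import Data.List using (List; []; _∷_; allFin; cartesianProduct; filter; length; map; mapMaybe)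
open import Data.List.Extrema.Nat using (max)
open import Data.List.Membership.Propositional using (_∈_)
open import Data.List.Membership.Propositional.Properties using (∈-allFin; ∈-cartesianProduct⁺)
open import Data.List.Relation.Unary.All using (All; []; _∷_)
open import Data.List.Relation.Unary.Any using (here; there)
open import Data.List.Relation.Unary.AllPairs using ([]; _∷_)
open import Data.List.Relation.Unary.Unique.Propositional using (Unique)
open import Data.List.Relation.Unary.Unique.Propositional.Properties using (allFin⁺; cartesianProduct⁺)
open import Data.Maybe using (Maybe; just; nothing)
open import Data.Product using (Σ; _×_; _,_)
open import Data.Sum using (_⊎_)
open import Data.Empty using (⊥-elim-irr)
open import Function using (Injective; _⤖_; Bijection)
open import Relation.Binary using (Rel; Symmetric; Irreflexive; Decidable)
open import Relation.Binary.PropositionalEquality using (_≡_; _≢_; refl; sym)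
open import Relation.Nullary using (Dec; yes; no)
open import Relation.Nullary.Decidable using (_⊎-dec_)

record Graph (n : ℕ) : Set₁ where
  field
    Adj     : Rel (Fin n) 0ℓ
    adj?    : Decidable Adj
    symm    : Symmetric Adj
    irrefl  : Irreflexive _≡_ Adj

open Graph public

module _ {n : ℕ} (G : Graph n) where

  degree : Fin n → ℕ
  degree v = length (filter (adj? G v) (allFin n))

  -- For n = 0 this is 0.
  Δ : ℕ
  Δ = max 0 (map degree (allFin n))

  -- An undirected edge is represented once, with its smaller endpoint first.
  -- The proofs are irrelevant, so edges are equal iff their endpoints are.
  record Edge : Set where
    constructor edge
    field
      lo hi  : Fin n
      .lo<hi : lo < hi
      .adj   : Adj G lo hi

  open Edge public

  Incident : Fin n → Edge → Set
  Incident v e = v ≡ lo e ⊎ v ≡ hi e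

  incident? : ∀ v e → Dec (Incident v e)
  incident? v e = (v ≟ lo e) ⊎-dec (v ≟ hi e)

  toEdge : Fin n × Fin n → Maybe Edge
  toEdge (u , v) with u <? v | adj? G u v
  ... | yes u<v | yes uv = just (edge u v u<v uv)
  ... | yes _   | no _   = nothing
  ... | no _    | _      = nothing

  -- Lists every edge exactly once: see edges-complete and edges-unique.
  edges : List Edge
  edges = mapMaybe toEdge (cartesianProduct (allFin n) (allFin n))

  size : ℕ
  size = length edges

  Labeling : Set
  Labeling = Edge ⤖ Fin size

  -- The labels are 1, …, size, whereas Fin size counts from 0.
  label : Labeling → Edge → ℕ
  label f e = suc (toℕ (Bijection.to f e))

  vertexSum : Labeling → Fin n → ℕ
  vertexSum f v = sum (map (label f) (filter (incident? v) edges))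

  IsAntimagic : Labeling → Set
  IsAntimagic f = Injective _≡_ _≡_ (vertexSum f)

  Antimagic : Set
  Antimagic = Σ Labeling IsAntimagic

  private
    ends : Edge → Fin n × Fin n
    ends e = lo e , hi e

    toEdge-ends : ∀ e → toEdge (ends e) ≡ just e
    toEdge-ends (edge u v u<v uv) with u <? v | adj? G u v
    ... | yes _  | yes _  = refl
    ... | yes _  | no ¬uv = ⊥-elim-irr (¬uv uv)
    ... | no u≮v | _      = ⊥-elim-irr (u≮v u<v)

    ends-toEdge : ∀ p {e} → toEdge p ≡ just e → p ≡ ends e
    ends-toEdge (u , v) eq with u <? v | adj? G u v
    ends-toEdge (u , v) refl | yes _ | yes _ = refl
    ends-toEdge (u , v) ()   | yes _ | no _
    ends-toEdge (u , v) ()   | no _  | _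

    complete : ∀ {e} ps → ends e ∈ ps → e ∈ mapMaybe toEdge ps
    complete {e} (p ∷ ps) (here refl) with toEdge (ends e) | toEdge-ends e
    ... | _ | refl = here refl
    complete (p ∷ ps) (there i) with toEdge p
    ... | just _  = there (complete ps i)
    ... | nothing = complete ps i

    fresh : ∀ {e} ps → All (ends e ≢_) ps → All (e ≢_) (mapMaybe toEdge ps)
    fresh [] [] = []
    fresh (p ∷ ps) (p≢ ∷ ps≢) with toEdge p in eq
    ... | just _  = (λ { refl → p≢ (sym (ends-toEdge p eq)) }) ∷ fresh ps ps≢
    ... | nothing = fresh ps ps≢

    unique : ∀ ps → Unique ps → Unique (mapMaybe toEdge ps)
    unique [] [] = []
    unique (p ∷ ps) (p≢ ∷ u) with toEdge p in eq
    ... | nothing = unique ps u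
    ... | just e with ends-toEdge p eq
    ...   | refl = fresh ps p≢ ∷ unique ps u

  edges-complete : ∀ e → e ∈ edges
  edges-complete e = complete _ (∈-cartesianProduct⁺ (∈-allFin (lo e)) (∈-allFin (hi e)))

  edges-unique : Unique edges
  edges-unique = unique _ (cartesianProduct⁺ (allFin⁺ n) (allFin⁺ n))

{-# OPTIONS --safe #-}

-- Let r be a vertex adjacent to all others.  Give the smallest labels to the
-- edges avoiding r, in any order, and let p v be the sum of these labels at v.
-- Give the remaining, largest labels to the edges rv in order of increasing p v.
-- Then the sums p v + label (rv) at the vertices v ≢ r are strictly increasing
-- in this order.  The sum at r is the largest: besides label (rv), it has n - 2 ≥ 1
-- further labels, at least as many as p v, and each exceeds every label in p v.
module Submission where

open import Defs hiding (lo; hi)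
open import Data.Nat using (ℕ; suc; _+_; _∸_; _≤_; _<_; z≤n; s≤s)
open import Data.Nat.ListAction using (sum)
open import Data.Nat.ListAction.Properties using (sum-++; sum-↭)
open import Data.Nat.Properties
  using ( ≤-trans; ≤-reflexive; ≤-totalOrder; ≤-decTotalOrder; <⇒≢; <⇒≱; <⇒≤; m≤m+n; m+[n∸m]≡n; ∸-monoˡ-≤
        ; +-suc; +-comm; +-identityʳ; +-cancelˡ-≤; +-mono-<; +-mono-<-≤; +-mono-≤-<; +-monoʳ-<; module ≤-Reasoning)
open import Data.Fin using (Fin; toℕ; cast; _≟_) renaming (zero to fzero; suc to fsuc)
open import Data.Fin.Properties using (toℕ-cast; toℕ-injective; injective⇒≤; ¬Fin0)
  renaming (<-cmp to Fin-<-cmp; <-irrefl to Fin-<-irrefl; <-asym to Fin-<-asym)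
open import Data.List using (List; []; _∷_; [_]; _++_; allFin; filter; length; lookup; map)
open import Data.List.Extrema ≤-totalOrder using (argmax-sel)
open import Data.List.Membership.Propositional using (_∈_)
open import Data.List.Membership.Propositional.Properties
  using (∈-allFin; ∈-lookup; ∈-map⁺; ∈-map⁻; ∈-filter⁺; ∈-filter⁻; ∈-++⁺ˡ; ∈-∃++; ∈-AllPairs₂)
open import Data.List.Membership.Propositional.Properties.WithK using (unique⇒irrelevant)
open import Data.List.Membership.Setoid.Properties using (index-injective)
open import Data.List.Properties
  using (filter-++; filter-all; filter-none; map-++; map-cong-local; length-map; length-tabulate)
open import Data.List.Relation.Binary.Permutation.Propositional
  using (_↭_; ↭-refl; ↭-sym; ↭-trans; ↭⇒↭ₛ; prep)
open import Data.List.Relation.Binary.Permutation.Propositional.Properties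
  using (∈-resp-↭; ↭-length; filter-↭; shift; ++⁺ˡ) renaming (map⁺ to ↭-map⁺)
import Data.List.Relation.Binary.Permutation.Setoid.Properties as ↭ₛ
open import Data.List.Relation.Unary.All as All using (All; []; _∷_)
import Data.List.Relation.Unary.All.Properties as All
open import Data.List.Relation.Unary.AllPairs as AllPairs using (AllPairs; []; _∷_)
open import Data.List.Relation.Unary.Any using (here; there; index)
open import Data.List.Relation.Unary.Sorted.TotalOrder.Properties using (Sorted⇒AllPairs)
open import Data.List.Relation.Unary.Unique.Propositional using (Unique)
open import Data.List.Relation.Unary.Unique.Propositional.Properties using (allFin⁺; filter⁺)
import Data.List.Sort as Sort
open import Data.Empty using (⊥-elim; ⊥-elim-irr)
open import Data.Product using (∃; _×_; _,_; proj₁; proj₂)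
open import Data.Sum using (inj₁; inj₂; [_,_]′)
open import Function using (_∘_; _on_; id; mk⤖)
open import Level using (Level)
open import Relation.Binary using (Rel; DecTotalOrder; tri<; tri≈; tri>)
import Relation.Binary.Construct.On as On
open import Relation.Binary.PropositionalEquality
  using (_≡_; _≢_; refl; sym; trans; cong; cong₂; subst; subst₂; setoid; ≢-sym; module ≡-Reasoning)
open import Relation.Nullary using (¬_; Dec; yes; no; contradiction)
open import Relation.Nullary.Decidable using (¬?)
open import Relation.Unary using (Pred; Decidable)

private
  variable
    a p ℓ : Level
    A B : Set a
    x y : A
    xs ys : List A

filter-∁-↭ : {P : Pred A p} (P? : Decidable P) (xs : List A) → filter (¬? ∘ P?) xs ++ filter P? xs ↭ xs
filter-∁-↭ P? [] = ↭-refl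
filter-∁-↭ P? (x ∷ xs) with P? x
... | yes px = ↭-trans (shift x _ _) (prep x (filter-∁-↭ P? xs))
... | no ¬px = prep x (filter-∁-↭ P? xs)

∈⇒↭∷ : x ∈ xs → ∃ λ ys → xs ↭ x ∷ ys
∈⇒↭∷ {x = x} x∈xs with ys , zs , refl ← ∈-∃++ x∈xs = ys ++ zs , shift x ys zs

Unique-index : Unique xs → (i : x ∈ xs) (j : y ∈ xs) → x ≡ y → index i ≡ index j
Unique-index u i j refl = cong index (unique⇒irrelevant u i j)

index-∈-lookup : (xs : List A) (i : Fin (length xs)) → index (∈-lookup {xs = xs} i) ≡ i
index-∈-lookup (x ∷ xs) fzero    = refl
index-∈-lookup (x ∷ xs) (fsuc i) = cong fsuc (index-∈-lookup xs i)

index-++⁺ˡ : (i : x ∈ xs) → toℕ (index (∈-++⁺ˡ {ys = ys} i)) ≡ toℕ (index i)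
index-++⁺ˡ (here _)  = refl
index-++⁺ˡ (there i) = cong suc (index-++⁺ˡ i)

Unique⊆⇒length≤ : Unique xs → (∀ {x} → x ∈ xs → x ∈ ys) → length xs ≤ length ys
Unique⊆⇒length≤ {xs = xs} u sub = injective⇒≤ {f = λ i → index (sub (∈-lookup {xs = xs} i))} λ {i} {j} eq →
  trans (sym (index-∈-lookup xs i))
    (trans (Unique-index u (∈-lookup i) (∈-lookup j)
             (index-injective (setoid _) (sub (∈-lookup {xs = xs} i)) (sub (∈-lookup {xs = xs} j)) eq))
           (index-∈-lookup xs j))

Unique⇒length≤n : ∀ {n} {xs : List (Fin n)} → Unique xs → length xs ≤ n
Unique⇒length≤n {n} {xs} u = subst (length xs ≤_) (length-tabulate id) (Unique⊆⇒length≤ u (λ {v} _ → ∈-allFin v))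

Unique-map : (f : A → B) → (∀ {x y} → x ∈ xs → y ∈ xs → f x ≡ f y → x ≡ y) → Unique xs → Unique (map f xs)
Unique-map f inj []        = []
Unique-map f inj (x≢ ∷ u) =
  All.map⁺ (All.tabulate λ i eq → All.lookup x≢ i (inj (here refl) (there i) eq))
  ∷ Unique-map f (λ i j → inj (there i) (there j)) u

Unique-constant : Unique xs → x ∈ xs → (∀ {y} → y ∈ xs → y ≡ x) → xs ≡ [ x ]
Unique-constant {xs = y ∷ []}     u _ ≡x = cong [_] (≡x (here refl))
Unique-constant {xs = y ∷ z ∷ xs} ((y≢z ∷ _) ∷ _) _ ≡x =
  contradiction (trans (≡x (here refl)) (sym (≡x (there (here refl))))) y≢z

AllPairs-++⁻ : {R : Rel A ℓ} (xs : List A) → AllPairs R (xs ++ ys) →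
               (∀ {x y} → x ∈ xs → y ∈ ys → R x y) × AllPairs R ys
AllPairs-++⁻ []       rs       = (λ ()) , rs
AllPairs-++⁻ (x ∷ xs) (r ∷ rs) with cross , rest ← AllPairs-++⁻ xs rs =
  (λ { (here refl) y∈ → All.lookup (All.++⁻ʳ xs r) y∈ ; (there x∈) y∈ → cross x∈ y∈ }) , rest

sum-map-mono-< : (f : A → ℕ) (xs ys : List A) → (∀ {x y} → x ∈ xs → y ∈ ys → f x < f y) → (∀ y → 0 < f y) →
                 length xs ≤ length ys → 0 < length ys → sum (map f xs) < sum (map f ys)
sum-map-mono-< f []       (y ∷ ys) lt pos _ _ = ≤-trans (pos y) (m≤m+n (f y) _)
sum-map-mono-< f (x ∷ []) (y ∷ ys) lt pos _ _ = +-mono-<-≤ (lt (here refl) (here refl)) z≤n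
sum-map-mono-< f (x ∷ xs@(_ ∷ _)) (y ∷ ys@(_ ∷ _)) lt pos (s≤s le) _ =
  +-mono-< (lt (here refl) (here refl))
    (sum-map-mono-< f xs ys (λ i j → lt (there i) (there j)) pos le (s≤s z≤n))

index⇒increasing : (g : A → ℕ) (c : ℕ) (xs : List A) → (∀ {x} (i : x ∈ xs) → g x ≡ c + toℕ (index i)) →
                   AllPairs (_<_ on g) xs
index⇒increasing g c []       _  = []
index⇒increasing g c (x ∷ xs) eq =
  All.tabulate (λ i → subst₂ _<_ (sym (eq (here refl))) (sym (eq (there i))) (+-monoʳ-< c (s≤s z≤n)))
  ∷ index⇒increasing g (suc c) xs (λ i → trans (eq (there i)) (+-suc c _))

sortOn : (q : A → ℕ) (xs : List A) → ∃ λ ys → ys ↭ xs × AllPairs (_≤_ on q) ys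
sortOn q xs = sort xs , sort-↭ xs , Sorted⇒AllPairs totalOrder (sort-↗ xs)
  where
  order = On.decTotalOrder ≤-decTotalOrder q
  open DecTotalOrder order using (totalOrder)
  open Sort order using (sort; sort-↭; sort-↗)

module _ {n : ℕ} (G : Graph n) where

  open Edge using (lo; hi)

  lo≢hi : (e : Edge G) → lo e ≢ hi e
  lo≢hi (edge u .u u<u _) refl = ⊥-elim-irr (Fin-<-irrefl refl u<u)

  other : Fin n → Edge G → Fin n
  other v e with v ≟ lo e
  ... | yes _ = hi e
  ... | no  _ = lo e

  other-incident : ∀ v e → Incident G (other v e) e
  other-incident v e with v ≟ lo e
  ... | yes _ = inj₂ refl
  ... | no  _ = inj₁ refl

  other-≢ : ∀ v e → v ≢ other v e
  other-≢ v e with v ≟ lo e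
  ... | yes refl = lo≢hi e
  ... | no v≢lo  = v≢lo

  other-unique : ∀ {u v} e → Incident G v e → Incident G u e → u ≢ v → u ≡ other v e
  other-unique {u} {v} e iv iu u≢v with v ≟ lo e | iv | iu
  ... | yes v≡lo | _         | inj₁ u≡lo = contradiction (trans u≡lo (sym v≡lo)) u≢v
  ... | yes v≡lo | _         | inj₂ u≡hi = u≡hi
  ... | no  v≢lo | inj₁ v≡lo | _         = contradiction v≡lo v≢lo
  ... | no  v≢lo | _         | inj₁ u≡lo = u≡lo
  ... | no  v≢lo | inj₂ v≡hi | inj₂ u≡hi = contradiction (trans u≡hi (sym v≡hi)) u≢v

  other-injective : ∀ {v} e e′ → Incident G v e → Incident G v e′ → other v e ≡ other v e′ → e ≡ e′
  other-injective {v} e e′ i i′ eq with v ≟ lo e | v ≟ lo e′ | i | i′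
  other-injective (edge u w u<w _) (edge _ _ u<w′ _) i i′ refl | yes refl | yes refl | _ | _ = refl
  other-injective (edge u w u<w _) (edge _ _ w<u _) i i′ refl | yes refl | no _ | _ | inj₂ refl = ⊥-elim-irr (Fin-<-asym u<w w<u)
  other-injective (edge u w u<w _) (edge _ _ w<u _) i i′ refl | no _ | yes refl | inj₂ refl | _ = ⊥-elim-irr (Fin-<-asym u<w w<u)
  other-injective (edge u w _ _)   (edge _ _ _ _)   i i′ refl | no _ | no _ | inj₂ refl | inj₂ refl = refl
  ... | yes _ | no ≢lo | _ | inj₁ ≡lo = contradiction ≡lo ≢lo
  ... | no ≢lo | _ | inj₁ ≡lo | _ = contradiction ≡lo ≢lo
  ... | no _ | no ≢lo | _ | inj₁ ≡lo = contradiction ≡lo ≢lo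

  joined-unique : ∀ {u v} e e′ → u ≢ v → Incident G v e → Incident G u e → Incident G v e′ → Incident G u e′ → e ≡ e′
  joined-unique e e′ u≢v iv iu iv′ iu′ = other-injective e e′ iv iv′
    (trans (sym (other-unique e iv iu u≢v)) (other-unique e′ iv′ iu′ u≢v))

  adjacent⇒joined : ∀ {u v} → Adj G u v → ∃ λ e → Incident G u e × Incident G v e
  adjacent⇒joined {u} {v} uv with Fin-<-cmp u v
  ... | tri< u<v _ _ = edge u v u<v uv , inj₁ refl , inj₂ refl
  ... | tri≈ _ u≡v _ = contradiction uv (irrefl G u≡v)
  ... | tri> _ _ v<u = edge v u v<u (symm G uv) , inj₂ refl , inj₁ refl

  Δ≡n∸1⇒universal : 2 ≤ n → Δ G ≡ n ∸ 1 → ∃ λ r → ∀ {v} → v ≢ r → Adj G r v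
  Δ≡n∸1⇒universal 2≤n Δ≡ with argmax-sel id 0 (map (degree G) (allFin n))
  ... | inj₁ Δ≡0 = contradiction (trans (sym Δ≡) Δ≡0) (≢-sym (<⇒≢ (∸-monoˡ-≤ 1 2≤n)))
  ... | inj₂ Δ∈ with r , _ , Δ≡deg ← ∈-map⁻ (degree G) Δ∈ = r , adjacent
    where
    nbrs = filter (adj? G r) (allFin n)

    ∈nbrs⇒adjacent : ∀ {u} → u ∈ nbrs → Adj G r u
    ∈nbrs⇒adjacent = proj₂ ∘ ∈-filter⁻ (adj? G r) {xs = allFin n}

    adjacent : ∀ {v} → v ≢ r → Adj G r v
    adjacent {v} v≢r with adj? G r v
    ... | yes rv = rv
    ... | no ¬rv = contradiction too-many (<⇒≱ (≤-reflexive (cong suc (sym (m+[n∸m]≡n (<⇒≤ 2≤n))))))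
      where
      too-many : 2 + (n ∸ 1) ≤ n
      too-many = subst (λ d → 2 + d ≤ n) (trans (sym Δ≡deg) Δ≡)
        (Unique⇒length≤n {xs = r ∷ v ∷ nbrs}
          ((≢-sym v≢r ∷ All.tabulate (λ i r≡u → irrefl G r≡u (∈nbrs⇒adjacent i)))
           ∷ All.tabulate (λ { i refl → ¬rv (∈nbrs⇒adjacent i) })
           ∷ filter⁺ (adj? G r) (allFin⁺ n)))

  module _ {L : List (Edge G)} (L↭ : L ↭ edges G) where

    private
      L-unique : Unique L
      L-unique = ↭ₛ.Unique-resp-↭ (setoid (Edge G)) (↭⇒↭ₛ (↭-sym L↭)) (edges-unique G)

      ∈L : ∀ e → e ∈ L
      ∈L e = ∈-resp-↭ (↭-sym L↭) (edges-complete G e)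

      position : Edge G → Fin (size G)
      position e = cast (↭-length L↭) (index (∈L e))

    listLabeling : Labeling G
    listLabeling = mk⤖ {to = position} (injective , surjective)
      where
      injective : ∀ {e e′} → position e ≡ position e′ → e ≡ e′
      injective {e} {e′} eq = index-injective (setoid _) (∈L e) (∈L e′) (toℕ-injective
        (trans (sym (toℕ-cast _ _)) (trans (cong toℕ eq) (toℕ-cast _ _))))

      surjective : ∀ i → ∃ λ e → ∀ {e′} → e′ ≡ e → position e′ ≡ i
      surjective i = lookup L j , λ { refl → toℕ-injective
          (trans (toℕ-cast _ _) (trans
            (cong toℕ (trans (Unique-index L-unique (∈L _) (∈-lookup j) refl) (index-∈-lookup L j)))
            (toℕ-cast _ i))) }
        where j = cast (sym (↭-length L↭)) i

    label-index : ∀ {e} (i : e ∈ L) → label G listLabeling e ≡ suc (toℕ (index i))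
    label-index {e} i = cong suc (trans (toℕ-cast _ _) (cong toℕ (Unique-index L-unique (∈L e) i refl)))

    label-increasing : AllPairs (_<_ on label G listLabeling) L
    label-increasing = index⇒increasing (label G listLabeling) 1 L label-index

    vertexSum-↭ : ∀ f v → vertexSum G f v ≡ sum (map (label G f) (filter (incident? G v) L))
    vertexSum-↭ f v = sum-↭ (↭-map⁺ (label G f) (filter-↭ (incident? G v) (↭-sym L↭)))

  module _ (3≤n : 3 ≤ n) {r : Fin n} (universal : ∀ {v} → v ≢ r → Adj G r v) where

    private
      avoiding through : List (Edge G)
      avoiding = filter (¬? ∘ incident? G r) (edges G)
      through  = filter (incident? G r) (edges G)

      -- The final labeling f depends on an order defined by its own values on
      -- avoiding; f₀ has the same values there and breaks the circularity.
      f₀ : Labeling G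
      f₀ = listLabeling (filter-∁-↭ (incident? G r) (edges G))

      at : Fin n → List (Edge G)
      at v = filter (incident? G v) avoiding

      partialSum : Fin n → ℕ
      partialSum v = sum (map (label G f₀) (at v))

      spokes-sorted = sortOn (partialSum ∘ other r) through

      spokes : List (Edge G)
      spokes = proj₁ spokes-sorted

      spokes↭ : spokes ↭ through
      spokes↭ = proj₁ (proj₂ spokes-sorted)

      L↭ : avoiding ++ spokes ↭ edges G
      L↭ = ↭-trans (++⁺ˡ avoiding spokes↭) (filter-∁-↭ (incident? G r) (edges G))

      f : Labeling G
      f = listLabeling L↭

      ∈avoiding⇒¬incident : ∀ {e} → e ∈ avoiding → ¬ Incident G r e
      ∈avoiding⇒¬incident = proj₂ ∘ ∈-filter⁻ (¬? ∘ incident? G r) {xs = edges G}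

      ∈spokes⇒incident : ∀ {e} → e ∈ spokes → Incident G r e
      ∈spokes⇒incident = proj₂ ∘ ∈-filter⁻ (incident? G r) {xs = edges G} ∘ ∈-resp-↭ spokes↭

      incident⇒∈spokes : ∀ {e} → Incident G r e → e ∈ spokes
      incident⇒∈spokes {e} = ∈-resp-↭ (↭-sym spokes↭) ∘ ∈-filter⁺ (incident? G r) (edges-complete G e)

      spokes-unique : Unique spokes
      spokes-unique = ↭ₛ.Unique-resp-↭ (setoid (Edge G)) (↭⇒↭ₛ (↭-sym spokes↭))
        (filter⁺ (incident? G r) (edges-unique G))

      avoiding<spokes : ∀ {e e′} → e ∈ avoiding → e′ ∈ spokes → label G f e < label G f e′
      avoiding<spokes = proj₁ (AllPairs-++⁻ avoiding (label-increasing L↭))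

      spokes-increasing : AllPairs (λ e e′ → partialSum (other r e) ≤ partialSum (other r e′) × label G f e < label G f e′) spokes
      spokes-increasing = AllPairs.zip (proj₂ (proj₂ spokes-sorted) , proj₂ (AllPairs-++⁻ avoiding (label-increasing L↭)))

      ∈at⇒ : ∀ {v e} → e ∈ at v → e ∈ avoiding × Incident G v e
      ∈at⇒ {v} = ∈-filter⁻ (incident? G v) {xs = avoiding}

      f≡f₀ : ∀ {e} → e ∈ avoiding → label G f e ≡ label G f₀ e
      f≡f₀ i = begin
        label G f _                   ≡⟨ label-index L↭ (∈-++⁺ˡ i) ⟩
        suc (toℕ (index (∈-++⁺ˡ i)))  ≡⟨ cong suc (index-++⁺ˡ i) ⟩
        suc (toℕ (index i))           ≡⟨ cong suc (index-++⁺ˡ i) ⟨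
        suc (toℕ (index (∈-++⁺ˡ i)))  ≡⟨ label-index (filter-∁-↭ (incident? G r) (edges G)) (∈-++⁺ˡ i) ⟨
        label G f₀ _                  ∎
        where open ≡-Reasoning

      f-partialSum : ∀ v → sum (map (label G f) (at v)) ≡ partialSum v
      f-partialSum v = cong sum (map-cong-local {f = label G f} {g = label G f₀} {xs = at v}
        (All.tabulate λ i → f≡f₀ (proj₁ (∈at⇒ {v} i))))

      vertexSum-split : ∀ v → vertexSum G f v ≡
        sum (map (label G f) (at v)) + sum (map (label G f) (filter (incident? G v) spokes))
      vertexSum-split v = begin
        vertexSum G f v
          ≡⟨ vertexSum-↭ L↭ f v ⟩
        Σℓ (filter (incident? G v) (avoiding ++ spokes))
          ≡⟨ cong Σℓ (filter-++ (incident? G v) avoiding spokes) ⟩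
        Σℓ (at v ++ filter (incident? G v) spokes)
          ≡⟨ cong sum (map-++ (label G f) (at v) _) ⟩
        sum (map (label G f) (at v) ++ map (label G f) (filter (incident? G v) spokes))
          ≡⟨ sum-++ (map (label G f) (at v)) _ ⟩
        Σℓ (at v) + Σℓ (filter (incident? G v) spokes)
          ∎
        where
        open ≡-Reasoning
        Σℓ = sum ∘ map (label G f)

      centreSum : vertexSum G f r ≡ sum (map (label G f) spokes)
      centreSum = trans (vertexSum-split r) (cong₂ (λ es es′ → sum (map (label G f) es) + sum (map (label G f) es′))
        (filter-none (incident? G r) (All.tabulate ∈avoiding⇒¬incident))
        (filter-all (incident? G r) (All.tabulate ∈spokes⇒incident)))

      module Spoke {v : Fin n} (v≢r : v ≢ r) where
        private
          joined = adjacent⇒joined (universal v≢r)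

        spoke : Edge G
        spoke = proj₁ joined

        r-incident : Incident G r spoke
        r-incident = proj₁ (proj₂ joined)

        v-incident : Incident G v spoke
        v-incident = proj₂ (proj₂ joined)

        spoke∈ : spoke ∈ spokes
        spoke∈ = incident⇒∈spokes r-incident

        ≡other : v ≡ other r spoke
        ≡other = other-unique spoke r-incident v-incident v≢r

        rimSum : vertexSum G f v ≡ partialSum v + label G f spoke
        rimSum = trans (vertexSum-split v) (cong₂ _+_ (f-partialSum v)
          (trans (cong (sum ∘ map (label G f)) only-spoke) (+-identityʳ _)))
          where
          only-spoke : filter (incident? G v) spokes ≡ [ spoke ]
          only-spoke = Unique-constant (filter⁺ (incident? G v) spokes-unique)
            (∈-filter⁺ (incident? G v) spoke∈ v-incident)
            λ {e} i → let e∈ , iv = ∈-filter⁻ (incident? G v) {xs = spokes} i in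
              joined-unique e spoke v≢r (∈spokes⇒incident e∈) iv r-incident v-incident

      n≤1+spokes : n ≤ suc (length spokes)
      n≤1+spokes = subst₂ _≤_ (length-tabulate {n = n} id) (cong suc (length-map (other r) spokes))
        (Unique⊆⇒length≤ {ys = r ∷ map (other r) spokes} (allFin⁺ n) λ {v} _ → covered v)
        where
        covered : ∀ v → v ∈ r ∷ map (other r) spokes
        covered v with v ≟ r
        ... | yes v≡r = here v≡r
        ... | no v≢r  = there (subst (_∈ _) (sym ≡other) (∈-map⁺ (other r) spoke∈))
          where open Spoke v≢r

      2+at≤n : ∀ {v} → v ≢ r → 2 + length (at v) ≤ n
      2+at≤n {v} v≢r = subst (λ k → 2 + k ≤ n) (length-map (other v) (at v))
        (Unique⇒length≤n {xs = v ∷ r ∷ map (other v) (at v)}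
          ((v≢r ∷ All.map⁺ (All.tabulate λ {e} _ → other-≢ v e))
           ∷ All.map⁺ (All.tabulate λ {e} i r≡ →
               ∈avoiding⇒¬incident (proj₁ (∈at⇒ {v} i)) (subst (λ u → Incident G u e) (sym r≡) (other-incident v e)))
           ∷ Unique-map (other v)
               (λ {e} {e′} i j → other-injective e e′ (proj₂ (∈at⇒ {v} i)) (proj₂ (∈at⇒ {v} j)))
               (filter⁺ (incident? G v) (filter⁺ (¬? ∘ incident? G r) (edges-unique G)))))

      rim<centre : ∀ {v} → v ≢ r → vertexSum G f v < vertexSum G f r
      rim<centre {v} v≢r = begin-strict
        vertexSum G f v                                ≡⟨ rimSum ⟩
        partialSum v + label G f spoke                 ≡⟨ +-comm (partialSum v) _ ⟩
        label G f spoke + partialSum v                 ≡⟨ cong (label G f spoke +_) (f-partialSum v) ⟨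
        label G f spoke + sum (map (label G f) (at v)) <⟨ +-monoʳ-< (label G f spoke) (sum-map-mono-< (label G f) (at v) es at<es (λ _ → s≤s z≤n) at≤es es-nonempty) ⟩
        label G f spoke + sum (map (label G f) es)     ≡⟨ sum-↭ (↭-map⁺ (label G f) spokes↭∷) ⟨
        sum (map (label G f) spokes)                   ≡⟨ centreSum ⟨
        vertexSum G f r                                ∎
        where
        open Spoke v≢r
        open ≤-Reasoning

        es = proj₁ (∈⇒↭∷ spoke∈)

        spokes↭∷ : spokes ↭ spoke ∷ es
        spokes↭∷ = proj₂ (∈⇒↭∷ spoke∈)

        at<es : ∀ {e e′} → e ∈ at v → e′ ∈ es → label G f e < label G f e′
        at<es i j = avoiding<spokes (proj₁ (∈at⇒ {v} i)) (∈-resp-↭ (↭-sym spokes↭∷) (there j))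

        n≤2+es : n ≤ 2 + length es
        n≤2+es = subst (λ k → n ≤ suc k) (↭-length spokes↭∷) n≤1+spokes

        at≤es : length (at v) ≤ length es
        at≤es = +-cancelˡ-≤ 2 _ _ (≤-trans (2+at≤n v≢r) n≤2+es)

        es-nonempty : 0 < length es
        es-nonempty = +-cancelˡ-≤ 2 _ _ (≤-trans 3≤n n≤2+es)

      rim-< : ∀ {u v} (u≢r : u ≢ r) (v≢r : v ≢ r) →
              let e = Spoke.spoke u≢r; e′ = Spoke.spoke v≢r in
              partialSum (other r e) ≤ partialSum (other r e′) × label G f e < label G f e′ →
              vertexSum G f u < vertexSum G f v
      rim-< u≢r v≢r (≤partial , <label) = subst₂ _<_ (sym (Spoke.rimSum u≢r)) (sym (Spoke.rimSum v≢r))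
        (+-mono-≤-< (subst₂ (λ u v → partialSum u ≤ partialSum v) (sym (Spoke.≡other u≢r)) (sym (Spoke.≡other v≢r)) ≤partial) <label)

      rim-distinct : ∀ {u v} → u ≢ r → v ≢ r → vertexSum G f u ≡ vertexSum G f v → u ≡ v
      rim-distinct u≢r v≢r eq =
        [ (λ same → trans (Spoke.≡other u≢r) (trans (cong (other r) same) (sym (Spoke.≡other v≢r))))
        , [ (λ lt → contradiction eq (<⇒≢ (rim-< u≢r v≢r lt)))
          , (λ gt → contradiction (sym eq) (<⇒≢ (rim-< v≢r u≢r gt)))
          ]′
        ]′ (∈-AllPairs₂ spokes-increasing (Spoke.spoke∈ u≢r) (Spoke.spoke∈ v≢r))

    universal⇒antimagic : Antimagic G
    universal⇒antimagic = f , injective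
      where
      -- A with-abstraction over u ≟ r and v ≟ r would normalise the labels in eq.
      compare : ∀ {u v} → Dec (u ≡ r) → Dec (v ≡ r) → vertexSum G f u ≡ vertexSum G f v → u ≡ v
      compare (yes u≡r) (yes v≡r) eq = trans u≡r (sym v≡r)
      compare (yes refl) (no v≢r) eq = contradiction (sym eq) (<⇒≢ (rim<centre v≢r))
      compare (no u≢r) (yes refl) eq = contradiction eq (<⇒≢ (rim<centre u≢r))
      compare (no u≢r) (no v≢r)   eq = rim-distinct u≢r v≢r eq

      injective : IsAntimagic G f
      injective {u} {v} = compare (u ≟ r) (v ≟ r)

lemma4p1 : (n : ℕ) → n ≢ 2 → (G : Graph n) → Δ G ≡ n ∸ 1 → Antimagic G
lemma4p1 0 _ G _ = listLabeling G ↭-refl , λ {u} → ⊥-elim (¬Fin0 u)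
lemma4p1 1 _ G _ = listLabeling G ↭-refl , λ {u} {v} _ → Fin1-prop u v
  where
  Fin1-prop : (i j : Fin 1) → i ≡ j
  Fin1-prop fzero fzero = refl
lemma4p1 2 2≢2 _ _ = contradiction refl 2≢2
lemma4p1 (suc (suc (suc _))) _ G Δ≡ = universal⇒antimagic G (s≤s (s≤s (s≤s z≤n))) (proj₂ centre)
  where centre = Δ≡n∸1⇒universal G (s≤s (s≤s z≤n)) Δ≡
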